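{- Let $G$ and $H$ be connected graphs, each with at least $2$ vertices. Then $$\gamma(G\times H)=\frac{1}{\frac{1}{\gamma(G)}+\frac{1}{\gamma(H)}}.$$
   Context: For a finite simple undirected graph $G$ with $n$ vertices, let $\mathcal{F}=\{x\in\mathbb{R}^{V(G)} : \sum_{v} x_v = 0,\ \|x\|_\infty = 1\}$, for $x\in\mathcal{F}$ let $\gamma_x(G)=\max_{uv\in E(G)}|x_u-x_v|$, and $\gamma(G)=\min_{x\in\mathcal{F}}\gamma_x(G)$. The Cartesian product $G\times H$ has vertex set $V(G)\times V(H)$, with $(u_1,v_1)\sim(u_2,v_2)$ iff either $u_1\sim u_2$ in $G$ and $v_1=v_2$, or $u_1=u_2$ and $v_1\sim v_2$ in $H$. -}

module Defs where

open import Data.Fin using (Fin)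
import Data.Fin.Properties as Fin
open import Data.List.Base using (List; map; filter; foldr; tabulate; cartesianProduct)
open import Data.Nat.Base as ℕ using (ℕ)
import Data.Nat.Properties as ℕ
open import Data.Product using (_×_; _,_; proj₁; proj₂; ∃-syntax; Σ-syntax; uncurry)
open import Data.Product.Function.NonDependent.Propositional using (_×-↔_)
open import Data.Rational.Base as ℚ using (ℚ; 0ℚ; 1ℚ; ½)
import Data.Rational.Properties as ℚ
open import Data.Rational.Solver using (module +-*-Solver)
open import Data.Sum using (_⊎_; inj₁; inj₂; [_,_])
open import Function using (_∘_; _↔_; Inverse)
open import Function.Properties.Inverse using (↔-sym; ↔-trans; ↔⇒↣)
open import Relation.Binary.Construct.Closure.ReflexiveTransitive using (Star)
open import Relation.Binary.Definitions using (Symmetric; Irreflexive; Decidable; DecidableEquality)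
open import Relation.Binary.PropositionalEquality
  using (_≡_; refl; sym; trans; cong; cong₂; subst)
open import Relation.Nullary using (yes; no; contradiction)
open import Relation.Nullary.Decidable using (_⊎-dec_; _×-dec_; via-injection)

-- The real numbers: Cauchy sequences of rationals, with equality _≈_.  All
-- operations act termwise on the sequences.

IsCauchy : (ℕ → ℚ) → Set
IsCauchy s = ∀ ε → 0ℚ ℚ.< ε →
  ∃[ N ] (∀ m n → N ℕ.≤ m → N ℕ.≤ n → ℚ.∣ s m ℚ.- s n ∣ ℚ.≤ ε)

record ℝ : Set where
  constructor mkℝ
  field
    seq    : ℕ → ℚ
    cauchy : IsCauchy seq
open ℝ public

infix 4 _≈_ _≤_ _<_

_≈_ _≤_ _<_ : ℝ → ℝ → Set
x ≈ y = ∀ ε → 0ℚ ℚ.< ε → ∃[ N ] (∀ n → N ℕ.≤ n → ℚ.∣ seq x n ℚ.- seq y n ∣ ℚ.≤ ε)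
x ≤ y = ∀ ε → 0ℚ ℚ.< ε → ∃[ N ] (∀ n → N ℕ.≤ n → seq x n ℚ.≤ seq y n ℚ.+ ε)
x < y = ∃[ δ ] (0ℚ ℚ.< δ × ∃[ N ] (∀ n → N ℕ.≤ n → seq x n ℚ.+ δ ℚ.≤ seq y n))

private
  ∣∣-lub : ∀ p {r} → p ℚ.≤ r → ℚ.- p ℚ.≤ r → ℚ.∣ p ∣ ℚ.≤ r
  ∣∣-lub p {r} p≤r -p≤r with ℚ.∣p∣≡p∨∣p∣≡-p p
  ... | inj₁ e = subst (ℚ._≤ r) (sym e) p≤r
  ... | inj₂ e = subst (ℚ._≤ r) (sym e) -p≤r

  p≤∣p∣ : ∀ p → p ℚ.≤ ℚ.∣ p ∣
  p≤∣p∣ p with ℚ.≤-total 0ℚ p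
  ... | inj₁ 0≤p = ℚ.≤-reflexive (sym (ℚ.0≤p⇒∣p∣≡p 0≤p))
  ... | inj₂ p≤0 = ℚ.≤-trans p≤0 (ℚ.0≤∣p∣ p)

  neg-sub : ∀ p q → ℚ.- (p ℚ.- q) ≡ q ℚ.- p
  neg-sub = solve 2 (λ p q → :- (p :- q) := q :- p) refl
    where open +-*-Solver

  ∣p-q∣≡∣q-p∣ : ∀ p q → ℚ.∣ p ℚ.- q ∣ ≡ ℚ.∣ q ℚ.- p ∣
  ∣p-q∣≡∣q-p∣ p q = trans (sym (ℚ.∣-p∣≡∣p∣ (p ℚ.- q))) (cong ℚ.∣_∣ (neg-sub p q))

  p≤q+r⇒p-q≤r : ∀ p q r → p ℚ.≤ q ℚ.+ r → p ℚ.- q ℚ.≤ r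
  p≤q+r⇒p-q≤r p q r h = subst (p ℚ.- q ℚ.≤_)
    (solve 2 (λ q r → (q :+ r) :- q := r) refl q r)
    (ℚ.+-monoˡ-≤ (ℚ.- q) h)
    where open +-*-Solver

  p≤q+∣p-q∣ : ∀ p q → p ℚ.≤ q ℚ.+ ℚ.∣ p ℚ.- q ∣
  p≤q+∣p-q∣ p q = subst (ℚ._≤ q ℚ.+ ℚ.∣ p ℚ.- q ∣)
    (solve 2 (λ p q → q :+ (p :- q) := p) refl p q)
    (ℚ.+-monoʳ-≤ q (p≤∣p∣ (p ℚ.- q)))
    where open +-*-Solver

  neg-close : ∀ p q → ℚ.∣ ℚ.- p ℚ.- ℚ.- q ∣ ℚ.≤ ℚ.∣ p ℚ.- q ∣
  neg-close p q = ℚ.≤-reflexive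
    (trans (cong ℚ.∣_∣ (solve 2 (λ p q → :- p :- :- q := q :- p) refl p q)) (∣p-q∣≡∣q-p∣ q p))
    where open +-*-Solver

  abs-close : ∀ p q → ℚ.∣ ℚ.∣ p ∣ ℚ.- ℚ.∣ q ∣ ∣ ℚ.≤ ℚ.∣ p ℚ.- q ∣
  abs-close p q = ∣∣-lub (ℚ.∣ p ∣ ℚ.- ℚ.∣ q ∣) (half p q)
    (subst (ℚ._≤ ℚ.∣ p ℚ.- q ∣) (sym (neg-sub ℚ.∣ p ∣ ℚ.∣ q ∣))
      (subst (ℚ.∣ q ∣ ℚ.- ℚ.∣ p ∣ ℚ.≤_) (∣p-q∣≡∣q-p∣ q p) (half q p)))
    where
    open +-*-Solver
    half : ∀ p q → ℚ.∣ p ∣ ℚ.- ℚ.∣ q ∣ ℚ.≤ ℚ.∣ p ℚ.- q ∣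
    half p q = p≤q+r⇒p-q≤r ℚ.∣ p ∣ ℚ.∣ q ∣ ℚ.∣ p ℚ.- q ∣
      (subst (λ z → ℚ.∣ z ∣ ℚ.≤ ℚ.∣ q ∣ ℚ.+ ℚ.∣ p ℚ.- q ∣)
        (solve 2 (λ p q → q :+ (p :- q) := p) refl p q)
        (ℚ.∣p+q∣≤∣p∣+∣q∣ q (p ℚ.- q)))

  add-close : ∀ p q p′ q′ →
    ℚ.∣ (p ℚ.+ q) ℚ.- (p′ ℚ.+ q′) ∣ ℚ.≤ ℚ.∣ p ℚ.- p′ ∣ ℚ.+ ℚ.∣ q ℚ.- q′ ∣
  add-close p q p′ q′ =
    subst (λ z → ℚ.∣ z ∣ ℚ.≤ ℚ.∣ p ℚ.- p′ ∣ ℚ.+ ℚ.∣ q ℚ.- q′ ∣)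
      (solve 4 (λ p q p′ q′ → (p :- p′) :+ (q :- q′) := (p :+ q) :- (p′ :+ q′)) refl p q p′ q′)
      (ℚ.∣p+q∣≤∣p∣+∣q∣ (p ℚ.- p′) (q ℚ.- q′))
    where open +-*-Solver

  max-close : ∀ p q p′ q′ →
    ℚ.∣ (p ℚ.⊔ q) ℚ.- (p′ ℚ.⊔ q′) ∣ ℚ.≤ ℚ.∣ p ℚ.- p′ ∣ ℚ.+ ℚ.∣ q ℚ.- q′ ∣
  max-close p q p′ q′ = ∣∣-lub ((p ℚ.⊔ q) ℚ.- (p′ ℚ.⊔ q′)) (half p q p′ q′)
    (subst (ℚ._≤ ℚ.∣ p ℚ.- p′ ∣ ℚ.+ ℚ.∣ q ℚ.- q′ ∣) (sym (neg-sub (p ℚ.⊔ q) (p′ ℚ.⊔ q′)))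
      (subst ((p′ ℚ.⊔ q′) ℚ.- (p ℚ.⊔ q) ℚ.≤_)
        (cong₂ ℚ._+_ (∣p-q∣≡∣q-p∣ p′ p) (∣p-q∣≡∣q-p∣ q′ q))
        (half p′ q′ p q)))
    where
    half : ∀ p q p′ q′ →
      (p ℚ.⊔ q) ℚ.- (p′ ℚ.⊔ q′) ℚ.≤ ℚ.∣ p ℚ.- p′ ∣ ℚ.+ ℚ.∣ q ℚ.- q′ ∣
    half p q p′ q′ = p≤q+r⇒p-q≤r (p ℚ.⊔ q) (p′ ℚ.⊔ q′) (d ℚ.+ e) (ℚ.⊔-lub
      (ℚ.≤-trans (p≤q+∣p-q∣ p p′) (ℚ.+-mono-≤ (ℚ.p≤p⊔q p′ q′)
        (subst (ℚ._≤ d ℚ.+ e) (ℚ.+-identityʳ d) (ℚ.+-monoʳ-≤ d (ℚ.0≤∣p∣ (q ℚ.- q′))))))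
      (ℚ.≤-trans (p≤q+∣p-q∣ q q′) (ℚ.+-mono-≤ (ℚ.p≤q⊔p p′ q′)
        (subst (ℚ._≤ d ℚ.+ e) (ℚ.+-identityˡ e) (ℚ.+-monoˡ-≤ e (ℚ.0≤∣p∣ (p ℚ.- p′)))))))
      where
      d e : ℚ
      d = ℚ.∣ p ℚ.- p′ ∣
      e = ℚ.∣ q ℚ.- q′ ∣

  0<*0< : ∀ p q → 0ℚ ℚ.< p → 0ℚ ℚ.< q → 0ℚ ℚ.< p ℚ.* q
  0<*0< p q 0<p 0<q = subst (ℚ._< p ℚ.* q) (ℚ.*-zeroʳ p)
    (ℚ.*-monoʳ-<-pos p {{ℚ.positive 0<p}} 0<q)

  ½ε+½ε≡ε : ∀ ε → ½ ℚ.* ε ℚ.+ ½ ℚ.* ε ≡ ε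
  ½ε+½ε≡ε ε = trans (sym (ℚ.*-distribʳ-+ ε ½ ½)) (ℚ.*-identityˡ ε)

  lift₁ : (f : ℚ → ℚ) → (∀ p q → ℚ.∣ f p ℚ.- f q ∣ ℚ.≤ ℚ.∣ p ℚ.- q ∣) → ℝ → ℝ
  lift₁ f close x .seq n = f (seq x n)
  lift₁ f close x .cauchy ε 0<ε with cauchy x ε 0<ε
  ... | N , h = N , λ m n N≤m N≤n → ℚ.≤-trans (close (seq x m) (seq x n)) (h m n N≤m N≤n)

  lift₂ : (f : ℚ → ℚ → ℚ) →
          (∀ p q p′ q′ → ℚ.∣ f p q ℚ.- f p′ q′ ∣ ℚ.≤ ℚ.∣ p ℚ.- p′ ∣ ℚ.+ ℚ.∣ q ℚ.- q′ ∣) →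
          ℝ → ℝ → ℝ
  lift₂ f close x y .seq n = f (seq x n) (seq y n)
  lift₂ f close x y .cauchy ε 0<ε
    with cauchy x (½ ℚ.* ε) (0<*0< ½ ε (ℚ.positive⁻¹ ½) 0<ε)
       | cauchy y (½ ℚ.* ε) (0<*0< ½ ε (ℚ.positive⁻¹ ½) 0<ε)
  ... | M , h | N , k = M ℕ.⊔ N , λ m n ≤m ≤n →
    ℚ.≤-trans (close (seq x m) (seq y m) (seq x n) (seq y n))
      (subst (ℚ.∣ seq x m ℚ.- seq x n ∣ ℚ.+ ℚ.∣ seq y m ℚ.- seq y n ∣ ℚ.≤_) (½ε+½ε≡ε ε)
        (ℚ.+-mono-≤
          (h m n (ℕ.≤-trans (ℕ.m≤m⊔n M N) ≤m) (ℕ.≤-trans (ℕ.m≤m⊔n M N) ≤n))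
          (k m n (ℕ.≤-trans (ℕ.m≤n⊔m M N) ≤m) (ℕ.≤-trans (ℕ.m≤n⊔m M N) ≤n))))

fromℚ : ℚ → ℝ
fromℚ q .seq _ = q
fromℚ q .cauchy ε 0<ε = 0 , λ _ _ _ _ →
  ℚ.≤-trans (ℚ.≤-reflexive (cong ℚ.∣_∣ (ℚ.+-inverseʳ q))) (ℚ.<⇒≤ 0<ε)

0ℝ 1ℝ : ℝ
0ℝ = fromℚ 0ℚ
1ℝ = fromℚ 1ℚ

infixl 6 _+_ _-_ _⊔_
infix  8 -_

-_ ∣_∣ : ℝ → ℝ
-_ = lift₁ ℚ.-_ neg-close
∣_∣ = lift₁ ℚ.∣_∣ abs-close

_+_ _⊔_ : ℝ → ℝ → ℝ
_+_ = lift₂ ℚ._+_ add-close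
_⊔_ = lift₂ ℚ._⊔_ max-close

_-_ : ℝ → ℝ → ℝ
x - y = x + (- y)

-- The value at 0 is junk: a positive real has only finitely many zero terms.
recipℚ : ℚ → ℚ
recipℚ q with q ℚ.≟ 0ℚ
... | yes _  = 0ℚ
... | no q≢0 = (ℚ.1/ q) {{ℚ.≢-nonZero q≢0}}

private
  recip-inverse : ∀ q → 0ℚ ℚ.< q → q ℚ.* recipℚ q ≡ 1ℚ
  recip-inverse q 0<q with q ℚ.≟ 0ℚ
  ... | yes refl = contradiction 0<q (ℚ.<-irrefl refl)
  ... | no q≢0   = ℚ.*-inverseʳ q {{ℚ.≢-nonZero q≢0}}

  -- ∣1/p − 1/q∣ · p · q = ∣p − q∣ for positive p and q
  recip-dist : ∀ p q → 0ℚ ℚ.< p → 0ℚ ℚ.< q →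
    ℚ.∣ recipℚ p ℚ.- recipℚ q ∣ ℚ.* (p ℚ.* q) ≡ ℚ.∣ p ℚ.- q ∣
  recip-dist p q 0<p 0<q =
    trans (cong (ℚ.∣ a ℚ.- b ∣ ℚ.*_) (sym (ℚ.0≤p⇒∣p∣≡p (ℚ.<⇒≤ (0<*0< p q 0<p 0<q)))))
    (trans (sym (ℚ.∣p*q∣≡∣p∣*∣q∣ (a ℚ.- b) (p ℚ.* q)))
    (trans (cong ℚ.∣_∣ eq) (∣p-q∣≡∣q-p∣ q p)))
    where
    open +-*-Solver
    a b : ℚ
    a = recipℚ p
    b = recipℚ q
    eq : (a ℚ.- b) ℚ.* (p ℚ.* q) ≡ q ℚ.- p
    eq = trans
      (solve 4 (λ a b p q → (a :- b) :* (p :* q) := (p :* a) :* q :- (q :* b) :* p) refl a b p q)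
      (trans (cong₂ (λ u v → u ℚ.* q ℚ.- v ℚ.* p) (recip-inverse p 0<p) (recip-inverse q 0<q))
        (cong₂ ℚ._-_ (ℚ.*-identityˡ q) (ℚ.*-identityˡ p)))

recip : (x : ℝ) → 0ℝ < x → ℝ
recip x _ .seq n = recipℚ (seq x n)
recip x (δ , 0<δ , M , δ≤x) .cauchy ε 0<ε
  with cauchy x (ε ℚ.* (δ ℚ.* δ)) (0<*0< ε (δ ℚ.* δ) 0<ε (0<*0< δ δ 0<δ 0<δ))
... | N , h = M ℕ.⊔ N , λ m n ≤m ≤n → bound m n
      (δ≤ m (ℕ.≤-trans (ℕ.m≤m⊔n M N) ≤m)) (δ≤ n (ℕ.≤-trans (ℕ.m≤m⊔n M N) ≤n))
      (h m n (ℕ.≤-trans (ℕ.m≤n⊔m M N) ≤m) (ℕ.≤-trans (ℕ.m≤n⊔m M N) ≤n))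
  where
  δ≤ : ∀ n → M ℕ.≤ n → δ ℚ.≤ seq x n
  δ≤ n M≤n = subst (ℚ._≤ seq x n) (ℚ.+-identityˡ δ) (δ≤x n M≤n)

  bound : ∀ m n → δ ℚ.≤ seq x m → δ ℚ.≤ seq x n →
          ℚ.∣ seq x m ℚ.- seq x n ∣ ℚ.≤ ε ℚ.* (δ ℚ.* δ) →
          ℚ.∣ recipℚ (seq x m) ℚ.- recipℚ (seq x n) ∣ ℚ.≤ ε
  bound m n δ≤p δ≤q h = ℚ.*-cancelʳ-≤-pos (p ℚ.* q) {{ℚ.positive (0<*0< p q 0<p 0<q)}}
    (subst (ℚ._≤ ε ℚ.* (p ℚ.* q)) (sym (recip-dist p q 0<p 0<q))
      (ℚ.≤-trans h (ℚ.*-monoˡ-≤-nonNeg ε {{ℚ.nonNegative (ℚ.<⇒≤ 0<ε)}}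
        (ℚ.≤-trans (ℚ.*-monoˡ-≤-nonNeg δ {{ℚ.nonNegative (ℚ.<⇒≤ 0<δ)}} δ≤q)
                   (ℚ.*-monoʳ-≤-nonNeg q {{ℚ.nonNegative (ℚ.<⇒≤ 0<q)}} δ≤p)))))
    where
    p q : ℚ
    p = seq x m
    q = seq x n
    0<p : 0ℚ ℚ.< p
    0<p = ℚ.<-≤-trans 0<δ δ≤p
    0<q : 0ℚ ℚ.< q
    0<q = ℚ.<-≤-trans 0<δ δ≤q

sum : List ℝ → ℝ
sum = foldr _+_ 0ℝ

-- The maximum of a list of nonnegative reals (so starting from 0 is harmless).
max₀ : List ℝ → ℝ
max₀ = foldr _⊔_ 0ℝ

record Graph : Set₁ where
  infix 4 _~_ _~?_
  field
    V        : Set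
    order    : ℕ
    enum     : Fin order ↔ V
    _~_      : V → V → Set
    _~?_     : Decidable _~_
    ~-sym    : Symmetric _~_
    ~-irrefl : Irreflexive _≡_ _~_

  vertices : List V
  vertices = tabulate (Inverse.to enum)

  -- Every edge is listed in both orientations.
  edges : List (V × V)
  edges = filter (uncurry _~?_) (cartesianProduct vertices vertices)

  _≟_ : DecidableEquality V
  _≟_ = via-injection (↔⇒↣ (↔-sym enum)) Fin._≟_

Connected : Graph → Set
Connected G = ∀ u v → Star _~_ u v
  where open Graph G

infixr 7 _□_

_□_ : Graph → Graph → Graph
G □ H = record
  { V        = G.V × H.V
  ; order    = G.order ℕ.* H.order
  ; enum     = ↔-trans Fin.*↔× (G.enum ×-↔ H.enum)
  ; _~_      = λ (u₁ , v₁) (u₂ , v₂) → (u₁ G.~ u₂ × v₁ ≡ v₂) ⊎ (u₁ ≡ u₂ × v₁ H.~ v₂)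
  ; _~?_     = λ (u₁ , v₁) (u₂ , v₂) →
                 (u₁ G.~? u₂ ×-dec v₁ H.≟ v₂) ⊎-dec (u₁ G.≟ u₂ ×-dec v₁ H.~? v₂)
  ; ~-sym    = λ { (inj₁ (a , e)) → inj₁ (G.~-sym a , sym e)
                 ; (inj₂ (e , a)) → inj₂ (sym e , H.~-sym a) }
  ; ~-irrefl = λ { refl (inj₁ (a , _)) → G.~-irrefl refl a
                 ; refl (inj₂ (_ , a)) → H.~-irrefl refl a }
  }
  where
  module G = Graph G
  module H = Graph H

module _ (G : Graph) where
  open Graph G

  ‖_‖∞ : (V → ℝ) → ℝ
  ‖ x ‖∞ = max₀ (map (λ v → ∣ x v ∣) vertices)

  𝓕 : (V → ℝ) → Set
  𝓕 x = sum (map x vertices) ≈ 0ℝ × ‖_‖∞ x ≈ 1ℝ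

  γₓ : (V → ℝ) → ℝ
  γₓ x = max₀ (map (λ (u , v) → ∣ x u - x v ∣) edges)

  -- γ(G) = g, i.e. g is the minimum of γₓ over 𝓕: it is attained and is a
  -- lower bound.  By γ-unique this determines g up to _≈_.
  γ-is : ℝ → Set
  γ-is g = (∃[ x ] (𝓕 x × γₓ x ≈ g)) × (∀ x → 𝓕 x → g ≤ γₓ x)

private
  ≤-close : ∀ {x y z} → x ≤ y → y ≈ z → x ≤ z
  ≤-close {x} {y} {z} x≤y y≈z ε 0<ε
    with x≤y (½ ℚ.* ε) (0<*0< ½ ε (ℚ.positive⁻¹ ½) 0<ε)
       | y≈z (½ ℚ.* ε) (0<*0< ½ ε (ℚ.positive⁻¹ ½) 0<ε)
  ... | M , h | N , k = M ℕ.⊔ N , λ n ≤n →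
    ℚ.≤-trans (h n (ℕ.≤-trans (ℕ.m≤m⊔n M N) ≤n))
      (ℚ.≤-trans
        (ℚ.+-monoˡ-≤ (½ ℚ.* ε) (ℚ.≤-trans (p≤q+∣p-q∣ (seq y n) (seq z n))
          (ℚ.+-monoʳ-≤ (seq z n) (k n (ℕ.≤-trans (ℕ.m≤n⊔m M N) ≤n)))))
        (ℚ.≤-reflexive (trans (ℚ.+-assoc (seq z n) (½ ℚ.* ε) (½ ℚ.* ε))
          (cong (seq z n ℚ.+_) (½ε+½ε≡ε ε)))))

  ≤-antisym : ∀ {x y} → x ≤ y → y ≤ x → x ≈ y
  ≤-antisym {x} {y} x≤y y≤x ε 0<ε with x≤y ε 0<ε | y≤x ε 0<ε
  ... | M , h | N , k = M ℕ.⊔ N , λ n ≤n →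
    ∣∣-lub (seq x n ℚ.- seq y n)
      (p≤q+r⇒p-q≤r (seq x n) (seq y n) ε (h n (ℕ.≤-trans (ℕ.m≤m⊔n M N) ≤n)))
      (subst (ℚ._≤ ε) (sym (neg-sub (seq x n) (seq y n)))
        (p≤q+r⇒p-q≤r (seq y n) (seq x n) ε (k n (ℕ.≤-trans (ℕ.m≤n⊔m M N) ≤n))))

γ-unique : ∀ G {g h} → γ-is G g → γ-is G h → g ≈ h
γ-unique G {g} {h} ((x , x∈𝓕 , γx≈g) , g≤) ((y , y∈𝓕 , γy≈h) , h≤) = ≤-antisym {g} {h}
  (≤-close {g} {γₓ G y} {h} (g≤ y y∈𝓕) γy≈h)
  (≤-close {h} {γₓ G x} {g} (h≤ x x∈𝓕) γx≈g)

{-# OPTIONS --safe #-}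

-- Let d be the graph distance, W(v) = Σ_u d(v,u) and n the order.  A vector x with edge
-- differences at most c satisfies |x_v − x_u| ≤ c d(v,u), so summing over u gives
-- n |x_v| ≤ c W(v) + |Σ x|.  Hence γ(G) ≥ n / max W.  If v maximises W, the vector
-- 1 − q d(v,·) with q = n / W(v) attains this bound: it has sum zero, and its entries are at
-- least −1 because n d(v,u) ≤ Σ_w (d(v,w) + d(u,w)) = W(v) + W(u) ≤ 2 W(v).  Thus
-- 1/γ(G) = max W / n, and distances in G □ H add: W(u,v) = n_H W(u) + n_G W(v).
module Submission where

open import Defs
open import Data.Fin.Base using (Fin; combine; _↑ˡ_; _↑ʳ_)
import Data.Fin.Base as Fin
import Data.Fin.Properties as Fin
open import Data.List.Base using (List; []; _∷_; _++_; map; foldr; tabulate; cartesianProduct)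
open import Data.List.Membership.Propositional using (_∈_)
open import Data.List.Membership.Propositional.Properties
  using (∈-tabulate⁺; ∈-filter⁺; ∈-filter⁻; ∈-cartesianProduct⁺)
open import Data.List.Properties using (map-tabulate; tabulate-cong)
import Data.List.Relation.Unary.All as All
open import Data.List.Relation.Unary.Any using (here; there)
open import Data.Nat.Base as ℕ using (ℕ; zero; suc)
import Data.Nat.Properties as ℕ
open import Data.Product using (_×_; _,_; proj₁; proj₂; Σ-syntax; ∃-syntax; uncurry)
open import Data.Rational.Base as ℚ using (ℚ; 0ℚ; 1ℚ; ½)
import Data.Rational.Properties as ℚ
open import Data.Rational.Solver using (module +-*-Solver)
open import Data.Sum using (inj₁; inj₂)
open import Function using (_∘_; Inverse; Injection)
open import Function.Properties.Inverse using (↔⇒↣)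
open import Relation.Binary.Bundles using (DecTotalOrder)
open import Relation.Binary.Construct.Closure.ReflexiveTransitive using (Star; _◅_) renaming (ε to done)
open import Relation.Binary.PropositionalEquality
  using (_≡_; _≢_; refl; sym; trans; cong; cong₂; subst; subst₂)
open import Relation.Nullary using (yes; no; contradiction)
open import Relation.Nullary.Decidable using (map′; _×-dec_)
open import Relation.Unary using (Decidable)
open import Data.List.Extrema (DecTotalOrder.totalOrder ℚ.≤-decTotalOrder)
  using (argmax; f[xs]≤f[argmax])

private
  variable
    A B : Set

-- Arithmetic of the ordered field of rationals.

0<p*q : ∀ {p q} → 0ℚ ℚ.< p → 0ℚ ℚ.< q → 0ℚ ℚ.< p ℚ.* q
0<p*q {p} {q} 0<p 0<q = subst (ℚ._< p ℚ.* q) (ℚ.*-zeroʳ p) (ℚ.*-monoʳ-<-pos p {{ℚ.positive 0<p}} 0<q)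

*-monoʳ-≤ : ∀ {r p q} → 0ℚ ℚ.≤ r → p ℚ.≤ q → r ℚ.* p ℚ.≤ r ℚ.* q
*-monoʳ-≤ {r} 0≤r = ℚ.*-monoˡ-≤-nonNeg r {{ℚ.nonNegative 0≤r}}

*-cancelˡ-≤ : ∀ {r p q} → 0ℚ ℚ.< r → r ℚ.* p ℚ.≤ r ℚ.* q → p ℚ.≤ q
*-cancelˡ-≤ {r} 0<r = ℚ.*-cancelˡ-≤-pos r {{ℚ.positive 0<r}}

p≤∣p∣ : ∀ p → p ℚ.≤ ℚ.∣ p ∣
p≤∣p∣ p with ℚ.≤-total 0ℚ p
... | inj₁ 0≤p = ℚ.≤-reflexive (sym (ℚ.0≤p⇒∣p∣≡p 0≤p))
... | inj₂ p≤0 = ℚ.≤-trans p≤0 (ℚ.0≤∣p∣ p)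

∣p∣≤ : ∀ {p r} → ℚ.- r ℚ.≤ p → p ℚ.≤ r → ℚ.∣ p ∣ ℚ.≤ r
∣p∣≤ {p} {r} -r≤p p≤r with ℚ.∣p∣≡p∨∣p∣≡-p p
... | inj₁ e = subst (ℚ._≤ r) (sym e) p≤r
... | inj₂ e = subst₂ ℚ._≤_ (sym e) (solve 1 (λ r → :- (:- r) := r) refl r) (ℚ.neg-antimono-≤ -r≤p)
  where open +-*-Solver

*-recipℚ : ∀ {q} → 0ℚ ℚ.< q → q ℚ.* recipℚ q ≡ 1ℚ
*-recipℚ {q} 0<q with q ℚ.≟ 0ℚ
... | yes refl = contradiction 0<q (ℚ.<-irrefl refl)
... | no q≢0   = ℚ.*-inverseʳ q {{ℚ.≢-nonZero q≢0}}

recipℚ-positive : ∀ {q} → 0ℚ ℚ.< q → 0ℚ ℚ.< recipℚ q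
recipℚ-positive {q} 0<q with q ℚ.≟ 0ℚ
... | yes refl = contradiction 0<q (ℚ.<-irrefl refl)
... | no q≢0   = ℚ.positive⁻¹ _ {{ℚ.1/pos⇒pos q {{ℚ.positive 0<q}}}}

-- Recursive, so that `fromℕ (suc k)` unfolds to `1ℚ + fromℕ k`: one more edge of a walk adds one
-- more unit.
fromℕ : ℕ → ℚ
fromℕ zero    = 0ℚ
fromℕ (suc k) = 1ℚ ℚ.+ fromℕ k

fromℕ-+ : ∀ j k → fromℕ (j ℕ.+ k) ≡ fromℕ j ℚ.+ fromℕ k
fromℕ-+ zero    k = sym (ℚ.+-identityˡ _)
fromℕ-+ (suc j) k = trans (cong (1ℚ ℚ.+_) (fromℕ-+ j k)) (sym (ℚ.+-assoc 1ℚ (fromℕ j) (fromℕ k)))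

0≤fromℕ : ∀ k → 0ℚ ℚ.≤ fromℕ k
0≤fromℕ zero    = ℚ.≤-refl
0≤fromℕ (suc k) = ℚ.+-mono-≤ (ℚ.nonNegative⁻¹ 1ℚ) (0≤fromℕ k)

fromℕ-mono : ∀ {j k} → j ℕ.≤ k → fromℕ j ℚ.≤ fromℕ k
fromℕ-mono {k = k} ℕ.z≤n = 0≤fromℕ k
fromℕ-mono (ℕ.s≤s j≤k)   = ℚ.+-monoʳ-≤ 1ℚ (fromℕ-mono j≤k)

-- Finite sums and maxima over lists.

∑ : (A → ℚ) → List A → ℚ
∑ f = foldr (λ a s → f a ℚ.+ s) 0ℚ

-- Scaling, addition, subtraction and the sum of a constant are all instances. Keeping `h` apart
-- from the linear combination reduces each use to a pointwise ring identity.
∑-linear : ∀ p q (f g : A → ℚ) {h : A → ℚ} → (∀ a → h a ≡ p ℚ.* f a ℚ.+ q ℚ.* g a) →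
           ∀ as → ∑ h as ≡ p ℚ.* ∑ f as ℚ.+ q ℚ.* ∑ g as
∑-linear p q f g eq [] = solve 2 (λ p q → con 0ℚ := p :* con 0ℚ :+ q :* con 0ℚ) refl p q
  where open +-*-Solver
∑-linear p q f g eq (a ∷ as) = trans (cong₂ ℚ._+_ (eq a) (∑-linear p q f g eq as))
  (solve 6 (λ p q x y s t → (p :* x :+ q :* y) :+ (p :* s :+ q :* t) := p :* (x :+ s) :+ q :* (y :+ t))
     refl p q (f a) (g a) (∑ f as) (∑ g as))
  where open +-*-Solver

∑-mono : {f g : A → ℚ} → (∀ a → f a ℚ.≤ g a) → ∀ as → ∑ f as ℚ.≤ ∑ g as
∑-mono f≤g []       = ℚ.≤-refl
∑-mono f≤g (a ∷ as) = ℚ.+-mono-≤ (f≤g a) (∑-mono f≤g as)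

0≤∑ : {f : A → ℚ} → (∀ a → 0ℚ ℚ.≤ f a) → ∀ as → 0ℚ ℚ.≤ ∑ f as
0≤∑ 0≤f []       = ℚ.≤-refl
0≤∑ 0≤f (a ∷ as) = ℚ.+-mono-≤ (0≤f a) (0≤∑ 0≤f as)

∣∑∣≤∑∣∣ : (f : A → ℚ) → ∀ as → ℚ.∣ ∑ f as ∣ ℚ.≤ ∑ (λ a → ℚ.∣ f a ∣) as
∣∑∣≤∑∣∣ f []       = ℚ.≤-refl
∣∑∣≤∑∣∣ f (a ∷ as) = ℚ.≤-trans (ℚ.∣p+q∣≤∣p∣+∣q∣ (f a) (∑ f as))
  (ℚ.+-monoʳ-≤ ℚ.∣ f a ∣ (∣∑∣≤∑∣∣ f as))

term≤∑ : {f : A → ℚ} → (∀ a → 0ℚ ℚ.≤ f a) → ∀ {a as} → a ∈ as → f a ℚ.≤ ∑ f as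
term≤∑ {f = f} 0≤f {a} (here {xs = as} refl) =
  subst (ℚ._≤ f a ℚ.+ ∑ f as) (ℚ.+-identityʳ (f a)) (ℚ.+-monoʳ-≤ (f a) (0≤∑ 0≤f as))
term≤∑ {f = f} 0≤f {a} (there {x = b} {xs = as} a∈as) =
  subst (ℚ._≤ f b ℚ.+ ∑ f as) (ℚ.+-identityˡ (f a)) (ℚ.+-mono-≤ (0≤f b) (term≤∑ 0≤f a∈as))

∑-++ : (f : A → ℚ) → ∀ as bs → ∑ f (as ++ bs) ≡ ∑ f as ℚ.+ ∑ f bs
∑-++ f []       bs = sym (ℚ.+-identityˡ _)
∑-++ f (a ∷ as) bs = trans (cong (f a ℚ.+_) (∑-++ f as bs)) (sym (ℚ.+-assoc (f a) (∑ f as) (∑ f bs)))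

∑-map : (f : B → ℚ) (g : A → B) → ∀ as → ∑ f (map g as) ≡ ∑ (f ∘ g) as
∑-map f g []       = refl
∑-map f g (a ∷ as) = cong (f (g a) ℚ.+_) (∑-map f g as)

∑-cartesianProduct : (f : A × B → ℚ) → ∀ as bs →
  ∑ f (cartesianProduct as bs) ≡ ∑ (λ a → ∑ (λ b → f (a , b)) bs) as
∑-cartesianProduct f []       bs = refl
∑-cartesianProduct f (a ∷ as) bs = trans (∑-++ f (map (a ,_) bs) (cartesianProduct as bs))
  (cong₂ ℚ._+_ (∑-map f (a ,_) bs) (∑-cartesianProduct f as bs))

-- Folds from 0 just as `max₀` does, so that the two agree index by index in `seq-max₀`.
⋁ : (A → ℚ) → List A → ℚ
⋁ f = foldr (λ a s → f a ℚ.⊔ s) 0ℚ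

-- The fold equals 0 or one of the listed values. A general `P` lets a bound on a multiple of the
-- maximum go through without distributing the factor over `⊔`.
⋁-preserves : (P : ℚ → Set) {f : A → ℚ} → P 0ℚ → ∀ as → (∀ {a} → a ∈ as → P (f a)) → P (⋁ f as)
⋁-preserves P P0 []       Pf = P0
⋁-preserves P {f} P0 (a ∷ as) Pf with ℚ.⊔-sel (f a) (⋁ f as)
... | inj₁ e = subst P (sym e) (Pf (here refl))
... | inj₂ e = subst P (sym e) (⋁-preserves P P0 as (Pf ∘ there))

term≤⋁ : (f : A → ℚ) → ∀ {a as} → a ∈ as → f a ℚ.≤ ⋁ f as
term≤⋁ f (here {xs = as} refl)           = ℚ.p≤p⊔q (f _) (⋁ f as)
term≤⋁ f (there {x = b} {xs = as} a∈as) = ℚ.≤-trans (term≤⋁ f a∈as) (ℚ.p≤q⊔p (f b) (⋁ f as))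

0≤⋁ : (f : A → ℚ) → ∀ as → 0ℚ ℚ.≤ ⋁ f as
0≤⋁ f []       = ℚ.≤-refl
0≤⋁ f (a ∷ as) = ℚ.≤-trans (0≤⋁ f as) (ℚ.p≤q⊔p (f a) (⋁ f as))

-- Enumeration of pairs, and least witnesses.

tabulate-+ : ∀ m {n} (f : Fin (m ℕ.+ n) → A) →
             tabulate f ≡ tabulate (λ i → f (i ↑ˡ n)) ++ tabulate (λ j → f (m ↑ʳ j))
tabulate-+ zero    f = refl
tabulate-+ (suc m) f = cong (f Fin.zero ∷_) (tabulate-+ m (f ∘ Fin.suc))

-- `combine` numbers the pairs row by row, which is also the order of `cartesianProduct`; the
-- induction on `m` splits off the first row of `n` indices.
tabulate-combine : ∀ {m n} (f : Fin m → A) (g : Fin n → B) (h : Fin (m ℕ.* n) → A × B) →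
                   (∀ i j → h (combine i j) ≡ (f i , g j)) →
                   tabulate h ≡ cartesianProduct (tabulate f) (tabulate g)
tabulate-combine {m = zero}  f g h eq = refl
tabulate-combine {m = suc m} {n} f g h eq = trans (tabulate-+ n h) (cong₂ _++_
  (trans (tabulate-cong (eq Fin.zero)) (sym (map-tabulate g (f Fin.zero ,_))))
  (tabulate-combine (f ∘ Fin.suc) g (λ i → h (n ↑ʳ i)) (λ i → eq (Fin.suc i))))

-- Upward search from 0, bounded by the known witness `k`. It turns some walk into a shortest one.
least : ∀ {P : ℕ → Set} → Decidable P → ∀ k → P k → ∃[ m ] (P m × (∀ {j} → P j → m ℕ.≤ j))
least P? zero    p = 0 , p , λ _ → ℕ.z≤n
least P? (suc k) p with P? 0
... | yes p₀ = 0 , p₀ , λ _ → ℕ.z≤n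
... | no ¬p₀ with least (P? ∘ suc) k p
... | m , pm , min = suc m , pm , λ { {zero}  p₀ → contradiction p₀ ¬p₀
                                    ; {suc j} pj → ℕ.s≤s (min pj) }

-- Walks and graph distance.

module _ (G : Graph) where
  open Graph G

  -- The length is an index, so that the existence of a walk between two fixed vertices becomes a
  -- decidable predicate on lengths, as `least` requires.
  data Walk : ℕ → V → V → Set where
    []  : ∀ {v} → Walk 0 v v
    _∷_ : ∀ {k u w v} → u ~ w → Walk k w v → Walk (suc k) u v

  _++ʷ_ : ∀ {j k u v w} → Walk j u v → Walk k v w → Walk (j ℕ.+ k) u w
  []      ++ʷ q = q
  (e ∷ p) ++ʷ q = e ∷ (p ++ʷ q)

  reverse : ∀ {k u v} → Walk k u v → Walk k v u
  reverse []                  = []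
  reverse (_∷_ {k} {u} {v = v} e p) =
    subst (λ l → Walk l v u) (ℕ.+-comm k 1) (reverse p ++ʷ (~-sym e ∷ []))

  fromStar : ∀ {u v} → Star _~_ u v → ∃[ k ] Walk k u v
  fromStar done     = 0 , []
  fromStar (e ◅ p) = suc (proj₁ (fromStar p)) , e ∷ proj₂ (fromStar p)

  -- A nonempty walk is a first neighbour followed by a shorter walk, and there are only finitely
  -- many neighbours to try.
  walk? : ∀ u v → Decidable (λ k → Walk k u v)
  walk? u v zero    = map′ (λ { refl → [] }) (λ { [] → refl }) (u ≟ v)
  walk? u v (suc k) = map′
    (λ { (i , e , p) → e ∷ p })
    -- The search runs over indices, so the edge and the rest of the walk are transported from `w`
    -- to `to (from w)`.
    (λ { (_∷_ {w = w} e p) → from w ,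
         subst (λ w → u ~ w × Walk k w v) (sym (strictlyInverseˡ w)) (e , p) })
    (Fin.any? (λ i → (u ~? to i) ×-dec walk? (to i) v k))
    where open Inverse enum

  -- A specification of the distance function, so that a product graph can be given the sum of the
  -- distances in its factors instead of the result of a search.
  record Distance : Set where
    field
      dist    : V → V → ℕ
      walk    : ∀ u v → Walk (dist u v) u v
      minimal : ∀ {k u v} → Walk k u v → dist u v ℕ.≤ k

  connected⇒distance : Connected G → Distance
  connected⇒distance conn = record
    { dist    = λ u v → proj₁ (shortest u v)
    ; walk    = λ u v → proj₁ (proj₂ (shortest u v))
    ; minimal = λ {k} {u} {v} → proj₂ (proj₂ (shortest u v))
    }
    where
    shortest : ∀ u v → ∃[ m ] (Walk m u v × (∀ {j} → Walk j u v → m ℕ.≤ j))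
    shortest u v = let k , p = fromStar (conn u v) in least (walk? u v) k p

  ∈-vertices : ∀ v → v ∈ vertices
  ∈-vertices v = subst (_∈ vertices) (strictlyInverseˡ v) (∈-tabulate⁺ (from v))
    where open Inverse enum

  ∈-edges : ∀ {u v} → u ~ v → (u , v) ∈ edges
  ∈-edges e = ∈-filter⁺ (uncurry _~?_) (∈-cartesianProduct⁺ (∈-vertices _) (∈-vertices _)) e

  -- The order of the graph as a rational; being a sum over `vertices`, it is open to `∑-linear` and
  -- `∑-□`.
  size : ℚ
  size = ∑ (λ _ → 1ℚ) vertices

  1≤size : V → 1ℚ ℚ.≤ size
  1≤size v = term≤∑ (λ _ → ℚ.nonNegative⁻¹ 1ℚ) (∈-vertices v)

  -- The difference telescopes along the walk, and each edge contributes at most `c`.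
  walk-bound : ∀ (x : V → ℚ) {c} → (∀ {u v} → u ~ v → ℚ.∣ x u ℚ.- x v ∣ ℚ.≤ c) →
               ∀ {k u v} → Walk k u v → ℚ.∣ x u ℚ.- x v ∣ ℚ.≤ c ℚ.* fromℕ k
  walk-bound x {c} lip {v = v} [] = ℚ.≤-reflexive
    (trans (cong ℚ.∣_∣ (ℚ.+-inverseʳ (x v))) (sym (ℚ.*-zeroʳ c)))
  walk-bound x {c} lip (_∷_ {k} {u} {w} {v} e p) = subst₂ (λ a b → ℚ.∣ a ∣ ℚ.≤ b)
    (solve 3 (λ a b c → (a :- b) :+ (b :- c) := a :- c) refl (x u) (x w) (x v))
    (solve 2 (λ c k → c :+ c :* k := c :* (con 1ℚ :+ k)) refl c (fromℕ k))
    (ℚ.≤-trans (ℚ.∣p+q∣≤∣p∣+∣q∣ (x u ℚ.- x w) (x w ℚ.- x v))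
      (ℚ.+-mono-≤ (lip e) (walk-bound x lip p)))
    where open +-*-Solver

open Distance

-- Transmission (the sum of the distances from a vertex) and extremal vertices.

module _ {G : Graph} (D : Distance G) where
  open Graph G

  dist-refl : ∀ v → dist D v v ≡ 0
  dist-refl v = ℕ.n≤0⇒n≡0 (minimal D [])

  dist-sym : ∀ u v → dist D u v ≡ dist D v u
  dist-sym u v = ℕ.≤-antisym (minimal D (reverse G (walk D v u))) (minimal D (reverse G (walk D u v)))

  dist-triangle : ∀ u v w → dist D u w ℕ.≤ dist D u v ℕ.+ dist D v w
  dist-triangle u v w = minimal D (_++ʷ_ G (walk D u v) (walk D v w))

  dist-positive : ∀ {u v} → u ≢ v → 1 ℕ.≤ dist D u v
  dist-positive {u} {v} u≢v with dist D u v | walk D u v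
  ... | zero  | []    = contradiction refl u≢v
  ... | suc _ | _     = ℕ.s≤s ℕ.z≤n

  δ : V → V → ℚ
  δ u v = fromℕ (dist D u v)

  δ-edge : ∀ v {u w} → u ~ w → δ v u ℚ.≤ δ v w ℚ.+ 1ℚ
  δ-edge v {u} {w} e = subst (δ v u ℚ.≤_) (fromℕ-+ (dist D v w) 1)
    (fromℕ-mono (ℕ.≤-trans (dist-triangle v w u)
      (ℕ.+-monoʳ-≤ (dist D v w) (minimal D (~-sym e ∷ [])))))

  transmission : V → ℚ
  transmission v = ∑ (δ v) vertices

  -- Writes `size G * x v` as the sum of the differences `x v - x u` plus the sum of `x`. The term
  -- in the absolute sum is kept because, at a single index of its Cauchy sequences, a vector of `𝓕`
  -- has a sum that is only close to zero.
  size*∣x∣≤ : ∀ (x : V → ℚ) {c} → (∀ {u v} → u ~ v → ℚ.∣ x u ℚ.- x v ∣ ℚ.≤ c) →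
              ∀ v → size G ℚ.* ℚ.∣ x v ∣ ℚ.≤ c ℚ.* transmission v ℚ.+ ℚ.∣ ∑ x vertices ∣
  size*∣x∣≤ x {c} lip v = begin
    size G ℚ.* ℚ.∣ x v ∣                              ≡⟨ cong (ℚ._* ℚ.∣ x v ∣) (ℚ.0≤p⇒∣p∣≡p 0≤n) ⟨
    ℚ.∣ size G ∣ ℚ.* ℚ.∣ x v ∣                        ≡⟨ ℚ.∣p*q∣≡∣p∣*∣q∣ (size G) (x v) ⟨
    ℚ.∣ size G ℚ.* x v ∣                              ≡⟨ cong ℚ.∣_∣ split ⟩
    ℚ.∣ ∑ (λ u → x v ℚ.- x u) vertices ℚ.+ ∑ x vertices ∣
      ≤⟨ ℚ.∣p+q∣≤∣p∣+∣q∣ (∑ (λ u → x v ℚ.- x u) vertices) (∑ x vertices) ⟩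
    ℚ.∣ ∑ (λ u → x v ℚ.- x u) vertices ∣ ℚ.+ ℚ.∣ ∑ x vertices ∣
      ≤⟨ ℚ.+-monoˡ-≤ ℚ.∣ ∑ x vertices ∣ (∣∑∣≤∑∣∣ (λ u → x v ℚ.- x u) vertices) ⟩
    ∑ (λ u → ℚ.∣ x v ℚ.- x u ∣) vertices ℚ.+ ℚ.∣ ∑ x vertices ∣
      ≤⟨ ℚ.+-monoˡ-≤ ℚ.∣ ∑ x vertices ∣
           (∑-mono (λ u → walk-bound G x lip (walk D v u)) vertices) ⟩
    ∑ (λ u → c ℚ.* δ v u) vertices ℚ.+ ℚ.∣ ∑ x vertices ∣ ≡⟨ cong (ℚ._+ ℚ.∣ ∑ x vertices ∣) scale ⟩
    c ℚ.* transmission v ℚ.+ ℚ.∣ ∑ x vertices ∣       ∎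
    where
    open ℚ.≤-Reasoning
    open +-*-Solver
    0≤n : 0ℚ ℚ.≤ size G
    0≤n = 0≤∑ (λ _ → ℚ.nonNegative⁻¹ 1ℚ) vertices
    split : size G ℚ.* x v ≡ ∑ (λ u → x v ℚ.- x u) vertices ℚ.+ ∑ x vertices
    split = trans
      (solve 3 (λ n a s → n :* a := (a :* n :+ con (ℚ.- 1ℚ) :* s) :+ s) refl
        (size G) (x v) (∑ x vertices))
      (cong (ℚ._+ ∑ x vertices) (sym (∑-linear (x v) (ℚ.- 1ℚ) (λ _ → 1ℚ) x
        (λ u → solve 2 (λ a b → a :- b := a :* con 1ℚ :+ con (ℚ.- 1ℚ) :* b) refl (x v) (x u))
        vertices)))
    scale : ∑ (λ u → c ℚ.* δ v u) vertices ≡ c ℚ.* transmission v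
    scale = trans
      (∑-linear c 0ℚ (δ v) (δ v)
        (λ u → solve 2 (λ c a → c :* a := c :* a :+ con 0ℚ :* a) refl c (δ v u)) vertices)
      (solve 2 (λ c a → c :* a :+ con 0ℚ :* a := c :* a) refl c (transmission v))

  -- The triangle inequality through `w`, summed over all vertices `w`.
  size*δ≤ : ∀ u v → size G ℚ.* δ u v ℚ.≤ transmission u ℚ.+ transmission v
  size*δ≤ u v = subst₂ ℚ._≤_
    (trans (∑-linear (δ u v) 0ℚ (λ _ → 1ℚ) (λ _ → 1ℚ) (λ _ →
        solve 1 (λ d → d := d :* con 1ℚ :+ con 0ℚ :* con 1ℚ) refl (δ u v)) vertices)
      (solve 2 (λ d n → d :* n :+ con 0ℚ :* n := n :* d) refl (δ u v) (size G)))
    (trans (∑-linear 1ℚ 1ℚ (δ u) (δ v) (λ w →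
        solve 2 (λ a b → a :+ b := con 1ℚ :* a :+ con 1ℚ :* b) refl (δ u w) (δ v w)) vertices)
      (solve 2 (λ a b → con 1ℚ :* a :+ con 1ℚ :* b := a :+ b) refl (transmission u) (transmission v)))
    (∑-mono triangle vertices)
    where
    open +-*-Solver
    triangle : ∀ w → δ u v ℚ.≤ δ u w ℚ.+ δ v w
    triangle w = subst (δ u v ℚ.≤_) (fromℕ-+ (dist D u w) (dist D v w))
      (fromℕ-mono (subst (λ d → dist D u v ℕ.≤ dist D u w ℕ.+ d) (dist-sym w v) (dist-triangle u w v)))

  transmission-positive : ∀ {u v} → u ≢ v → 0ℚ ℚ.< transmission u
  transmission-positive {u} {v} u≢v = ℚ.<-≤-trans (ℚ.positive⁻¹ 1ℚ)
    (ℚ.≤-trans (fromℕ-mono (dist-positive u≢v))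
      (term≤∑ (λ w → 0≤fromℕ (dist D u w)) (∈-vertices G v)))

  Maximal : V → Set
  Maximal v = ∀ u → transmission u ℚ.≤ transmission v

  maximal : V → ∃[ v ] Maximal v
  maximal v = argmax transmission v vertices ,
    λ u → All.lookup (f[xs]≤f[argmax] {f = transmission} v vertices) (∈-vertices G u)

  -- Rational counterparts of `‖_‖∞` and `γₓ`, as seen at one index of the Cauchy sequences.
  ‖_‖ variation : (V → ℚ) → ℚ
  ‖ x ‖ = ⋁ (λ v → ℚ.∣ x v ∣) vertices
  variation x = ⋁ (λ (u , v) → ℚ.∣ x u ℚ.- x v ∣) edges

  -- A certificate that γ(G) is `q`, the order divided by the largest transmission. The quotient is
  -- recorded as a product equation, so that any expression for `q` can be certified by a ring
  -- identity.
  record Extremal : Set where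
    field
      vertex         : V
      vertex-maximal : Maximal vertex
      q              : ℚ
      0<q            : 0ℚ ℚ.< q
      q*transmission : q ℚ.* transmission vertex ≡ size G

    0<size : 0ℚ ℚ.< size G
    0<size = ℚ.<-≤-trans (ℚ.positive⁻¹ 1ℚ) (1≤size G vertex)

    0≤q : 0ℚ ℚ.≤ q
    0≤q = ℚ.<⇒≤ 0<q

    -- Multiplying size*∣x∣≤ by q turns q · transmission into the size, which then cancels.
    q*‖x‖≤ : ∀ x → q ℚ.* ‖ x ‖ ℚ.≤ variation x ℚ.+ q ℚ.* ℚ.∣ ∑ x vertices ∣
    q*‖x‖≤ x = ⋁-preserves (λ p → q ℚ.* p ℚ.≤ c ℚ.+ q ℚ.* s)
      (subst (ℚ._≤ c ℚ.+ q ℚ.* s) (sym (ℚ.*-zeroʳ q)) (ℚ.+-mono-≤ 0≤c 0≤qs))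
      vertices (λ {v} _ → *-cancelˡ-≤ 0<size (bound v))
      where
      open ℚ.≤-Reasoning
      open +-*-Solver
      n W c s : ℚ
      n = size G
      W = transmission vertex
      c = variation x
      s = ℚ.∣ ∑ x vertices ∣
      0≤c : 0ℚ ℚ.≤ c
      0≤c = 0≤⋁ (λ (u , v) → ℚ.∣ x u ℚ.- x v ∣) edges
      0≤qs : 0ℚ ℚ.≤ q ℚ.* s
      0≤qs = subst (ℚ._≤ q ℚ.* s) (ℚ.*-zeroʳ q) (*-monoʳ-≤ 0≤q (ℚ.0≤∣p∣ (∑ x vertices)))
      lipschitz : ∀ {u v} → u ~ v → ℚ.∣ x u ℚ.- x v ∣ ℚ.≤ c
      lipschitz e = term≤⋁ (λ (u , v) → ℚ.∣ x u ℚ.- x v ∣) (∈-edges G e)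
      bound : ∀ v → n ℚ.* (q ℚ.* ℚ.∣ x v ∣) ℚ.≤ n ℚ.* (c ℚ.+ q ℚ.* s)
      bound v = begin
        n ℚ.* (q ℚ.* ℚ.∣ x v ∣)
          ≡⟨ solve 3 (λ n q a → n :* (q :* a) := q :* (n :* a)) refl n q ℚ.∣ x v ∣ ⟩
        q ℚ.* (n ℚ.* ℚ.∣ x v ∣)          ≤⟨ *-monoʳ-≤ 0≤q (size*∣x∣≤ x lipschitz v) ⟩
        q ℚ.* (c ℚ.* transmission v ℚ.+ s)
          ≤⟨ *-monoʳ-≤ 0≤q (ℚ.+-monoˡ-≤ s (*-monoʳ-≤ 0≤c (vertex-maximal v))) ⟩
        q ℚ.* (c ℚ.* W ℚ.+ s)
          ≡⟨ solve 4 (λ q c W s → q :* (c :* W :+ s) := (q :* W) :* c :+ con 1ℚ :* (q :* s)) refl q c W s ⟩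
        (q ℚ.* W) ℚ.* c ℚ.+ 1ℚ ℚ.* (q ℚ.* s)
          ≡⟨ cong (λ t → t ℚ.* c ℚ.+ 1ℚ ℚ.* (q ℚ.* s)) q*transmission ⟩
        n ℚ.* c ℚ.+ 1ℚ ℚ.* (q ℚ.* s)
          -- Since the order is at least 1, the error term may be enlarged by the factor `n`, which
          -- can then be taken out of the whole sum.
          ≤⟨ ℚ.+-monoʳ-≤ (n ℚ.* c)
               (ℚ.*-monoʳ-≤-nonNeg (q ℚ.* s) {{ℚ.nonNegative 0≤qs}} (1≤size G vertex)) ⟩
        n ℚ.* c ℚ.+ n ℚ.* (q ℚ.* s)      ≡⟨ ℚ.*-distribˡ-+ n c (q ℚ.* s) ⟨
        n ℚ.* (c ℚ.+ q ℚ.* s)            ∎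

    optimum : V → ℚ
    optimum u = 1ℚ ℚ.- q ℚ.* δ vertex u

    ∑-optimum : ∑ optimum vertices ≡ 0ℚ
    ∑-optimum = trans
      (∑-linear 1ℚ (ℚ.- q) (λ _ → 1ℚ) (δ vertex)
        (λ u → solve 2 (λ q d → con 1ℚ :- q :* d := con 1ℚ :* con 1ℚ :+ (:- q) :* d) refl q (δ vertex u))
        vertices)
      (trans (cong (λ n → 1ℚ ℚ.* n ℚ.+ (ℚ.- q) ℚ.* transmission vertex) (sym q*transmission))
        (solve 2 (λ q W → con 1ℚ :* (q :* W) :+ (:- q) :* W := con 0ℚ) refl q (transmission vertex)))
      where open +-*-Solver

    q*δ≤2 : ∀ u → q ℚ.* δ vertex u ℚ.≤ 1ℚ ℚ.+ 1ℚ
    q*δ≤2 u = *-cancelˡ-≤ 0<size (begin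
      n ℚ.* (q ℚ.* d)            ≡⟨ solve 3 (λ n q d → n :* (q :* d) := q :* (n :* d)) refl n q d ⟩
      q ℚ.* (n ℚ.* d)            ≤⟨ *-monoʳ-≤ 0≤q (size*δ≤ vertex u) ⟩
      q ℚ.* (W ℚ.+ transmission u) ≤⟨ *-monoʳ-≤ 0≤q (ℚ.+-monoʳ-≤ W (vertex-maximal u)) ⟩
      q ℚ.* (W ℚ.+ W)
        ≡⟨ solve 2 (λ q W → q :* (W :+ W) := (q :* W) :* (con 1ℚ :+ con 1ℚ)) refl q W ⟩
      (q ℚ.* W) ℚ.* (1ℚ ℚ.+ 1ℚ)  ≡⟨ cong (ℚ._* (1ℚ ℚ.+ 1ℚ)) q*transmission ⟩
      n ℚ.* (1ℚ ℚ.+ 1ℚ)          ∎)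
      where
      open ℚ.≤-Reasoning
      open +-*-Solver
      n W d : ℚ
      n = size G
      W = transmission vertex
      d = δ vertex u

    -- The value 1 is attained at `vertex` itself, at distance 0; all other entries lie between -1
    -- and 1 because `q * δ` lies between 0 and 2.
    ‖optimum‖ : ‖ optimum ‖ ≡ 1ℚ
    ‖optimum‖ = ℚ.≤-antisym
      (⋁-preserves (ℚ._≤ 1ℚ) (ℚ.nonNegative⁻¹ 1ℚ) vertices (λ {u} _ → ∣p∣≤ (lower u) (upper u)))
      (subst (ℚ._≤ ‖ optimum ‖) (cong ℚ.∣_∣ optimum-vertex)
        (term≤⋁ (λ u → ℚ.∣ optimum u ∣) (∈-vertices G vertex)))
      where
      open +-*-Solver
      lower : ∀ u → ℚ.- 1ℚ ℚ.≤ optimum u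
      lower u = ℚ.+-monoʳ-≤ 1ℚ (ℚ.neg-antimono-≤ (q*δ≤2 u))
      upper : ∀ u → optimum u ℚ.≤ 1ℚ
      upper u = ℚ.+-monoʳ-≤ 1ℚ (ℚ.neg-antimono-≤
        (subst (ℚ._≤ q ℚ.* δ vertex u) (ℚ.*-zeroʳ q) (*-monoʳ-≤ 0≤q (0≤fromℕ (dist D vertex u)))))
      optimum-vertex : optimum vertex ≡ 1ℚ
      optimum-vertex = trans (cong (λ k → 1ℚ ℚ.- q ℚ.* fromℕ k) (dist-refl vertex))
        (solve 1 (λ q → con 1ℚ :- q :* con 0ℚ := con 1ℚ) refl q)

    -- At most `q`, because distances from `vertex` change by at most 1 along an edge. At least `q`,
    -- by the general bound `q*‖x‖≤` applied to `optimum` itself, so no edge with difference exactly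
    -- `q` has to be found.
    variation-optimum : variation optimum ≡ q
    variation-optimum = ℚ.≤-antisym
      (⋁-preserves (ℚ._≤ q) 0≤q edges λ {(u , v)} e →
        let u~v = proj₂ (∈-filter⁻ (uncurry _~?_) {xs = cartesianProduct vertices vertices} e) in
        ∣p∣≤ (subst (ℚ.- q ℚ.≤_) (neg-diff v u) (ℚ.neg-antimono-≤ (diff (~-sym u~v)))) (diff u~v))
      (subst₂ ℚ._≤_ (trans (cong (q ℚ.*_) ‖optimum‖) (ℚ.*-identityʳ q))
        (trans (cong (λ s → variation optimum ℚ.+ q ℚ.* ℚ.∣ s ∣) ∑-optimum)
          (solve 2 (λ c q → c :+ q :* con 0ℚ := c) refl (variation optimum) q))
        (q*‖x‖≤ optimum))
      where
      open +-*-Solver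
      neg-diff : ∀ u v → ℚ.- (optimum u ℚ.- optimum v) ≡ optimum v ℚ.- optimum u
      neg-diff u v = solve 2 (λ a b → :- (a :- b) := b :- a) refl (optimum u) (optimum v)
      diff : ∀ {u v} → u ~ v → optimum u ℚ.- optimum v ℚ.≤ q
      diff {u} {v} e = subst₂ ℚ._≤_
        (solve 3 (λ q a b → q :* b :+ :- (q :* a) := (con 1ℚ :- q :* a) :- (con 1ℚ :- q :* b)) refl
          q (δ vertex u) (δ vertex v))
        (solve 2 (λ q a → q :* (a :+ con 1ℚ) :+ :- (q :* a) := q) refl q (δ vertex u))
        (ℚ.+-monoˡ-≤ (ℚ.- (q ℚ.* δ vertex u)) (*-monoʳ-≤ 0≤q (δ-edge vertex (~-sym e))))

-- Passage from rational vectors to real ones.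

seq-sum : (x : A → ℝ) → ∀ as n → seq (sum (map x as)) n ≡ ∑ (λ a → seq (x a) n) as
seq-sum x []       n = refl
seq-sum x (a ∷ as) n = cong (seq (x a) n ℚ.+_) (seq-sum x as n)

seq-max₀ : (x : A → ℝ) → ∀ as n → seq (max₀ (map x as)) n ≡ ⋁ (λ a → seq (x a) n) as
seq-max₀ x []       n = refl
seq-max₀ x (a ∷ as) n = cong (seq (x a) n ℚ.⊔_) (seq-max₀ x as n)

pointwise⇒≈ : ∀ x y → (∀ n → seq x n ≡ seq y n) → x ≈ y
pointwise⇒≈ x y x≗y ε 0<ε = 0 , λ n _ → ℚ.≤-trans
  (ℚ.≤-reflexive (cong ℚ.∣_∣ (trans (cong (ℚ._- seq y n) (x≗y n)) (ℚ.+-inverseʳ (seq y n)))))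
  (ℚ.<⇒≤ 0<ε)

0<fromℚ : ∀ {q} → 0ℚ ℚ.< q → 0ℝ < fromℚ q
0<fromℚ {q} 0<q = q , 0<q , 0 , λ _ _ → ℚ.≤-reflexive (ℚ.+-identityˡ q)

module _ {G : Graph} {D : Distance G} (E : Extremal D) where
  open Graph G
  open Extremal E

  γ-attained : ∃[ x ] (𝓕 G x × γₓ G x ≈ fromℚ q)
  γ-attained = x ,
    (pointwise⇒≈ (sum (map x vertices)) 0ℝ sum≡0 , pointwise⇒≈ (‖_‖∞ G x) 1ℝ norm≡1) ,
    pointwise⇒≈ (γₓ G x) (fromℚ q) variation≡q
    where
    x : V → ℝ
    x = fromℚ ∘ optimum
    sum≡0 : ∀ n → seq (sum (map x vertices)) n ≡ 0ℚ
    sum≡0 n = trans (seq-sum x vertices n) ∑-optimum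
    norm≡1 : ∀ n → seq (‖_‖∞ G x) n ≡ 1ℚ
    norm≡1 n = trans (seq-max₀ (λ v → ∣ x v ∣) vertices n) ‖optimum‖
    variation≡q : ∀ n → seq (γₓ G x) n ≡ q
    variation≡q n = trans (seq-max₀ (λ (u , v) → ∣ x u - x v ∣) edges n) variation-optimum

  -- At a late index the rational vector has sum within η of 0 and norm within η of 1, so `q*‖x‖≤`
  -- bounds `q` by the variation plus 2qη.
  γ-lower-bound : ∀ x → 𝓕 G x → fromℚ q ≤ γₓ G x
  γ-lower-bound x (sum≈0 , norm≈1) ε 0<ε =
    let η , 0<η , qη+qη≡ε = tolerance
        M , sum-close     = sum≈0 η 0<η
        N , norm-close    = norm≈1 η 0<η
    in M ℕ.⊔ N , λ n ≤n → bound n qη+qη≡ε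
        (subst (λ s → ℚ.∣ s ∣ ℚ.≤ η) (trans (ℚ.+-identityʳ _) (seq-sum x vertices n))
          (sum-close n (ℕ.≤-trans (ℕ.m≤m⊔n M N) ≤n)))
        (subst (λ m → ℚ.∣ m ℚ.- 1ℚ ∣ ℚ.≤ η) (seq-max₀ (λ v → ∣ x v ∣) vertices n)
          (norm-close n (ℕ.≤-trans (ℕ.m≤n⊔m M N) ≤n)))
    where
    open ℚ.≤-Reasoning
    open +-*-Solver
    tolerance : ∃[ η ] (0ℚ ℚ.< η × q ℚ.* η ℚ.+ q ℚ.* η ≡ ε)
    -- η = ε / (2q): the error in the sum and the error in the norm cost qη each.
    tolerance = ½ ℚ.* ε ℚ.* recipℚ q
      , 0<p*q (0<p*q (ℚ.positive⁻¹ ½) 0<ε) (recipℚ-positive 0<q)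
      , trans (solve 3 (λ q e r → q :* (con ½ :* e :* r) :+ q :* (con ½ :* e :* r) := (q :* r) :* e) refl
                q ε (recipℚ q))
          (trans (cong (ℚ._* ε) (*-recipℚ 0<q)) (ℚ.*-identityˡ ε))
    bound : ∀ {η} n → q ℚ.* η ℚ.+ q ℚ.* η ≡ ε → ℚ.∣ ∑ (λ v → seq (x v) n) vertices ∣ ℚ.≤ η →
            ℚ.∣ ‖_‖ D (λ v → seq (x v) n) ℚ.- 1ℚ ∣ ℚ.≤ η → q ℚ.≤ seq (γₓ G x) n ℚ.+ ε
    bound {η} n qη+qη≡ε sum≤η norm≤η = begin
      q                              ≡⟨ ℚ.*-identityʳ q ⟨
      q ℚ.* 1ℚ
        ≡⟨ cong (q ℚ.*_) (solve 1 (λ m → con 1ℚ := m :+ :- (m :- con 1ℚ)) refl m) ⟩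
      q ℚ.* (m ℚ.+ ℚ.- (m ℚ.- 1ℚ))   ≤⟨ *-monoʳ-≤ 0≤q (ℚ.+-monoʳ-≤ m
                                          (ℚ.≤-trans (p≤∣p∣ (ℚ.- (m ℚ.- 1ℚ)))
                                            (subst (ℚ._≤ η) (sym (ℚ.∣-p∣≡∣p∣ (m ℚ.- 1ℚ))) norm≤η))) ⟩
      q ℚ.* (m ℚ.+ η)                ≡⟨ ℚ.*-distribˡ-+ q m η ⟩
      q ℚ.* m ℚ.+ q ℚ.* η            ≤⟨ ℚ.+-monoˡ-≤ (q ℚ.* η) (q*‖x‖≤ y) ⟩
      (c ℚ.+ q ℚ.* s) ℚ.+ q ℚ.* η    ≤⟨ ℚ.+-monoˡ-≤ (q ℚ.* η) (ℚ.+-monoʳ-≤ c (*-monoʳ-≤ 0≤q sum≤η)) ⟩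
      (c ℚ.+ q ℚ.* η) ℚ.+ q ℚ.* η    ≡⟨ ℚ.+-assoc c (q ℚ.* η) (q ℚ.* η) ⟩
      c ℚ.+ (q ℚ.* η ℚ.+ q ℚ.* η)
        ≡⟨ cong₂ ℚ._+_ (sym (seq-max₀ (λ (u , v) → ∣ x u - x v ∣) edges n)) qη+qη≡ε ⟩
      seq (γₓ G x) n ℚ.+ ε           ∎
      where
      y : V → ℚ
      y v = seq (x v) n
      m c s : ℚ
      m = ‖_‖ D y
      c = variation D y
      s = ℚ.∣ ∑ y vertices ∣

  extremal⇒γ : γ-is G (fromℚ q)
  extremal⇒γ = γ-attained , γ-lower-bound

-- Existence of an extremal vertex.

distinct-vertices : ∀ (G : Graph) → 2 ℕ.≤ Graph.order G → ∃[ u ] ∃[ v ] (u ≢ v)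
-- The vertices numbered 0 and 1; `2≤n` is by definition the strict bound for index 1.
distinct-vertices G 2≤n = to (Fin.fromℕ< 0<n) , to (Fin.fromℕ< 2≤n) , λ e →
  contradiction (trans (sym (Fin.toℕ-fromℕ< 0<n))
    (trans (cong Fin.toℕ (Injection.injective (↔⇒↣ enum) e)) (Fin.toℕ-fromℕ< 2≤n))) λ ()
  where
  open Graph G
  open Inverse enum
  0<n : 0 ℕ.< order
  0<n = ℕ.<⇒≤ 2≤n

maximal⇒extremal : ∀ {G} (D : Distance G) {v} → Maximal D v → 0ℚ ℚ.< transmission D v → Extremal D
maximal⇒extremal {G} D {v} v-maximal 0<W = record
  { vertex         = v
  ; vertex-maximal = v-maximal
  ; q              = size G ℚ.* recipℚ W
  ; 0<q            = 0<p*q (ℚ.<-≤-trans (ℚ.positive⁻¹ 1ℚ) (1≤size G v)) (recipℚ-positive 0<W)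
  ; q*transmission = trans
      (solve 3 (λ n r W → n :* r :* W := n :* (W :* r)) refl (size G) (recipℚ W) W)
      (trans (cong (size G ℚ.*_) (*-recipℚ 0<W)) (ℚ.*-identityʳ (size G)))
  }
  where
  open +-*-Solver
  W : ℚ
  W = transmission D v

-- Two distinct vertices make one transmission positive, hence also the largest one, by which the
-- order is then divided.
extremal : ∀ {G} (D : Distance G) → 2 ℕ.≤ Graph.order G → Extremal D
extremal {G} D 2≤n =
  let u , v , u≢v   = distinct-vertices G 2≤n
      w , w-maximal = maximal D u
  in maximal⇒extremal D w-maximal (ℚ.<-≤-trans (transmission-positive D u≢v) (w-maximal u))

-- Distances and transmissions in the Cartesian product.

module _ {G H : Graph} where
  private
    module G = Graph G
    module H = Graph H

  □-walkˡ : ∀ {k u u′} v → Walk G k u u′ → Walk (G □ H) k (u , v) (u′ , v)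
  □-walkˡ v []      = []
  □-walkˡ v (e ∷ p) = inj₁ (e , refl) ∷ □-walkˡ v p

  □-walkʳ : ∀ {k v v′} u → Walk H k v v′ → Walk (G □ H) k (u , v) (u , v′)
  □-walkʳ u []      = []
  □-walkʳ u (e ∷ p) = inj₂ (refl , e) ∷ □-walkʳ u p

  infixr 7 _□ᵈ_

  -- Walking first in `G` and then in `H` attains the sum. It is minimal because an edge of the
  -- product moves only one coordinate, so it lowers only one of the two distances, and by at most
  -- 1.
  _□ᵈ_ : Distance G → Distance H → Distance (G □ H)
  D □ᵈ E = record
    { dist    = λ (u , v) (u′ , v′) → dist D u u′ ℕ.+ dist E v v′
    ; walk    = λ (u , v) (u′ , v′) → _++ʷ_ (G □ H) (□-walkˡ v (walk D u u′)) (□-walkʳ u′ (walk E v v′))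
    ; minimal = minimal-□
    }
    where
    minimal-□ : ∀ {k u v u′ v′} → Walk (G □ H) k (u , v) (u′ , v′) → dist D u u′ ℕ.+ dist E v v′ ℕ.≤ k
    minimal-□ {u = u} {v} [] = ℕ.≤-reflexive (cong₂ ℕ._+_ (dist-refl D u) (dist-refl E v))
    minimal-□ {u = u} {v} {u′} {v′} (_∷_ {w = w , _} (inj₁ (e , refl)) p) = ℕ.≤-trans
      (ℕ.+-monoˡ-≤ (dist E v v′) (minimal D (e ∷ walk D w u′)))
      (ℕ.s≤s (minimal-□ p))
    minimal-□ {u = u} {v} {u′} {v′} (_∷_ {w = _ , w} (inj₂ (refl , e)) p) = ℕ.≤-trans
      (ℕ.+-monoʳ-≤ (dist D u u′) (minimal E (e ∷ walk E w v′)))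
      (ℕ.≤-trans (ℕ.≤-reflexive (ℕ.+-suc (dist D u u′) (dist E w v′))) (ℕ.s≤s (minimal-□ p)))

  -- The enumeration of the product decodes an index by `remQuot`, the inverse of `combine`, so the
  -- vertices are listed row by row.
  vertices-□ : Graph.vertices (G □ H) ≡ cartesianProduct G.vertices H.vertices
  vertices-□ = tabulate-combine (Inverse.to G.enum) (Inverse.to H.enum) (Inverse.to (Graph.enum (G □ H)))
    (λ i j → cong (λ (i , j) → Inverse.to G.enum i , Inverse.to H.enum j) (Fin.remQuot-combine i j))

  ∑-□ : ∀ f → ∑ f (Graph.vertices (G □ H)) ≡ ∑ (λ u → ∑ (λ v → f (u , v)) H.vertices) G.vertices
  ∑-□ f = trans (cong (∑ f) vertices-□) (∑-cartesianProduct f G.vertices H.vertices)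

  size-□ : size (G □ H) ≡ size G ℚ.* size H
  size-□ = trans (∑-□ (λ _ → 1ℚ)) (trans
    (∑-linear (size H) 0ℚ (λ _ → 1ℚ) (λ _ → 1ℚ)
      (λ _ → solve 1 (λ n → n := n :* con 1ℚ :+ con 0ℚ :* con 1ℚ) refl (size H)) G.vertices)
    (solve 2 (λ m n → n :* m :+ con 0ℚ :* m := m :* n) refl (size G) (size H)))
    where open +-*-Solver

  -- Summed over all pairs, each distance in one factor is counted once for every vertex of the
  -- other.
  transmission-□ : ∀ D E u v → transmission (D □ᵈ E) (u , v) ≡
                   size H ℚ.* transmission D u ℚ.+ size G ℚ.* transmission E v
  transmission-□ D E u v = trans (∑-□ (δ (D □ᵈ E) (u , v))) (trans
    (∑-linear (size H) (transmission E v) (δ D u) (λ _ → 1ℚ) inner G.vertices)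
    (cong (size H ℚ.* transmission D u ℚ.+_) (ℚ.*-comm (transmission E v) (size G))))
    where
    open +-*-Solver
    inner : ∀ u′ → ∑ (λ v′ → δ (D □ᵈ E) (u , v) (u′ , v′)) H.vertices ≡
                   size H ℚ.* δ D u u′ ℚ.+ transmission E v ℚ.* 1ℚ
    inner u′ = trans
      (∑-linear (δ D u u′) 1ℚ (λ _ → 1ℚ) (δ E v) (λ v′ → trans (fromℕ-+ (dist D u u′) (dist E v v′))
        (solve 2 (λ a b → a :+ b := a :* con 1ℚ :+ con 1ℚ :* b) refl (δ D u u′) (δ E v v′))) H.vertices)
      (solve 3 (λ d n W → d :* n :+ con 1ℚ :* W := n :* d :+ W :* con 1ℚ) refl
        (δ D u u′) (size H) (transmission E v))

  -- By `transmission-□` the transmission is a positively weighted sum of one term per coordinate,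
  -- so it is maximised coordinate by coordinate.
  extremal-□ : ∀ {D E} → Extremal D → Extremal E → Extremal (D □ᵈ E)
  extremal-□ {D} {E} X Y = record
    { vertex         = X.vertex , Y.vertex
    ; vertex-maximal = λ (u , v) → subst₂ ℚ._≤_
        (sym (transmission-□ D E u v)) (sym (transmission-□ D E X.vertex Y.vertex))
        (ℚ.+-mono-≤ (*-monoʳ-≤ (ℚ.<⇒≤ Y.0<size) (X.vertex-maximal u))
                    (*-monoʳ-≤ (ℚ.<⇒≤ X.0<size) (Y.vertex-maximal v)))
    -- Chosen as the very expression in the theorem, so that the final comparison holds by
    -- computation.
    ; q              = recipℚ s
    ; 0<q            = recipℚ-positive 0<s
    ; q*transmission = trans (cong (recipℚ s ℚ.*_) W≡s*n) (trans
        (solve 3 (λ r s n → r :* (s :* n) := (s :* r) :* n) refl (recipℚ s) s (size (G □ H)))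
        (trans (cong (ℚ._* size (G □ H)) (*-recipℚ 0<s)) (ℚ.*-identityˡ (size (G □ H)))))
    }
    where
    module X = Extremal X
    module Y = Extremal Y
    open +-*-Solver
    a b s : ℚ
    a = recipℚ X.q
    b = recipℚ Y.q
    s = a ℚ.+ b
    0<s : 0ℚ ℚ.< s
    0<s = ℚ.+-mono-< (recipℚ-positive X.0<q) (recipℚ-positive Y.0<q)
    -- The largest transmission per vertex is 1/q; in this form the additivity of transmissions
    -- becomes the additivity of reciprocals.
    W≡r*n : ∀ {K} {F : Distance K} (Z : Extremal F) →
      transmission F (Extremal.vertex Z) ≡ recipℚ (Extremal.q Z) ℚ.* size K
    W≡r*n {K} {F} Z = trans (sym (ℚ.*-identityˡ W)) (trans (cong (ℚ._* W) (sym (*-recipℚ Z.0<q))) (trans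
      (solve 3 (λ q r W → (q :* r) :* W := r :* (q :* W)) refl Z.q (recipℚ Z.q) W)
      (cong (recipℚ Z.q ℚ.*_) Z.q*transmission)))
      where
      module Z = Extremal Z
      W : ℚ
      W = transmission F Z.vertex
    W≡s*n : transmission (D □ᵈ E) (X.vertex , Y.vertex) ≡ s ℚ.* size (G □ H)
    W≡s*n = trans (transmission-□ D E X.vertex Y.vertex) (trans
      (cong₂ (λ V W → size H ℚ.* V ℚ.+ size G ℚ.* W) (W≡r*n X) (W≡r*n Y)) (trans
      (solve 4 (λ a b m n → n :* (a :* m) :+ m :* (b :* n) := (a :+ b) :* (m :* n)) refl
        a b (size G) (size H))
      (cong (s ℚ.*_) (sym size-□))))

-- The reciprocal formula for γ of a Cartesian product.

theorem5p1 : (G H : Graph) → Connected G → Connected H →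
    2 ℕ.≤ Graph.order G → 2 ℕ.≤ Graph.order H →
    ∃[ g ] ∃[ h ] ∃[ k ]
    (γ-is G g × γ-is H h × γ-is (G □ H) k ×
    Σ[ g>0 ∈ 0ℝ < g ] Σ[ h>0 ∈ 0ℝ < h ]
    Σ[ s>0 ∈ 0ℝ < recip g g>0 + recip h h>0 ]
    (k ≈ recip (recip g g>0 + recip h h>0) s>0))
theorem5p1 G H connG connH 2≤m 2≤n =
  fromℚ X.q , fromℚ Y.q , fromℚ Z.q ,
  extremal⇒γ X , extremal⇒γ Y , extremal⇒γ Z ,
  g>0 , h>0 , s>0 ,
  -- All three values are constant sequences, and `recip` and `_+_` act termwise, so both sides have
  -- the same rational at every index.
  pointwise⇒≈ (fromℚ Z.q) (recip (recip (fromℚ X.q) g>0 + recip (fromℚ Y.q) h>0) s>0) (λ _ → refl)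
  where
  X = extremal (connected⇒distance G connG) 2≤m
  Y = extremal (connected⇒distance H connH) 2≤n
  Z = extremal-□ X Y
  module X = Extremal X
  module Y = Extremal Y
  module Z = Extremal Z
  g>0 : 0ℝ < fromℚ X.q
  g>0 = 0<fromℚ X.0<q
  h>0 : 0ℝ < fromℚ Y.q
  h>0 = 0<fromℚ Y.0<q
  s>0 : 0ℝ < recip (fromℚ X.q) g>0 + recip (fromℚ Y.q) h>0
  s>0 = 0<fromℚ (ℚ.+-mono-< (recipℚ-positive X.0<q) (recipℚ-positive Y.0<q))
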